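{- Let $\mathbf L=(L,\vee,\wedge,*)$ be a sectionally pseudocomplemented lattice with greatest element $1$ and $F\subseteq L$. Then $F\in\operatorname{Fil}\mathbf L$ if and only if $F$ is closed with respect to the following ideal terms: \begin{align*} t_1 & :=1, \\ t_2(x_1,x_2,x_3,y_1,y_2) & :=(((x_1\vee x_2)\wedge(y_1*x_2)\wedge y_2)\vee x_3)*(x_2\vee x_3), \\ t_3(x_1,x_2,x_3,y_1,y_2) & :=(((x_1\vee x_2)\wedge(y_1*x_2)\wedge y_2)\wedge x_3)*(x_2\wedge x_3), \\ t_4(x_1,x_2,x_3,y_1,y_2) & :=(((x_1\vee x_2)\wedge(y_1*x_2)\wedge y_2)*x_3)*(x_2*x_3), \\ t_5(x_1,x_2,x_3,y_1,y_2) & :=(x_3*x_1)*(x_3*((x_1\vee x_2)\wedge(y_2*x_1)\wedge y_1)). \end{align*}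
   Context: A lattice $(L,\vee,\wedge)$ is sectionally pseudocomplemented if for all $a,b\in L$ there exists a greatest element $c$ of $L$ satisfying $(a\vee b)\wedge c=b$; this $c$ is denoted by $a*b$. Sectionally pseudocomplemented lattices are regarded as algebras $(L,\vee,\wedge,*)$ of type $(2,2,2)$. Only non-empty lattices are considered; then there is a greatest element $1$ (namely $x*x=1$ for every $x\in L$). A filter of $\mathbf L$ is a subset $F$ of $L$ containing $1$ such that, for all $x,y,z\in L$, $x*y,y*x\in F$ implies $(x\vee z)*(y\vee z),\ (x\wedge z)*(y\wedge z),\ (x*z)*(y*z),\ (z*x)*(z*y)\in F$. $\operatorname{Fil}\mathbf L$ is the set of all filters of $\mathbf L$. An ideal term is a term $t(x_1,\ldots,x_n,y_1,\ldots,y_m)$ in the language of sectionally pseudocomplemented lattices satisfying the identity $t(x_1,\ldots,x_n,1,\ldots,1)\approx1$. A subset $A\subseteq L$ is closed with respect to ideal terms $t_i(x_1,\ldots,x_n,y_1,\ldots,y_m)$, $i\in I$, if for every $i\in I$, all $x_1,\ldots,x_n\in L$ and all $y_1,\ldots,y_m\in A$ one has $t_i(x_1,\ldots,x_n,y_1,\ldots,y_m)\in A$ (for $t_1$ this means $1\in A$). -}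

module Defs where

open import Algebra.Lattice.Bundles using (Lattice)
import Algebra.Lattice.Properties.Lattice as LatticeProperties
open import Data.Fin.Base using (Fin)
open import Data.Fin.Patterns using (0F; 1F; 2F)
open import Data.Nat.Base using (ℕ)
open import Data.Product.Base using (_×_; _,_; proj₁; proj₂)
open import Data.Vec.Functional using (Vector; []; _∷_)
open import Level using (Level; _⊔_; suc)
open import Relation.Binary.Bundles using (Poset)
open import Relation.Binary.Core using (Rel)
open import Relation.Binary.Definitions using (Maximum)
import Relation.Binary.Lattice as OrderLattice
import Relation.Binary.Reasoning.Setoid as SetoidReasoning
open import Relation.Unary using (Pred; _∈_)

private
  variable
    a c ℓ ℓ₁ ℓ₂ p i : Level
    n m : ℕ

IsGreatest : {A : Set a} → Rel A ℓ₁ → Pred A ℓ₂ → A → Set (a ⊔ ℓ₁ ⊔ ℓ₂)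
IsGreatest _≤_ P x = x ∈ P × (∀ y → y ∈ P → y ≤ x)

-- The order is the natural order of the lattice: x ≤ y unfolds to x ≈ x ∧ y.
-- The operation _*_ needs no congruence axiom, since a greatest element is
-- unique up to ≈ (see *-cong).
record SectionallyPseudocomplementedLattice c ℓ : Set (suc (c ⊔ ℓ)) where
  infixr 8 _*_
  field
    lattice : Lattice c ℓ

  open Lattice lattice public
  open LatticeProperties lattice public
    using (poset; ∧-idem; ∨-idem; ∨-∧-orderTheoreticLattice)
  open Poset poset public
    using (_≤_; antisym)

  field
    _*_        : Carrier → Carrier → Carrier
    *-greatest : ∀ x y → IsGreatest _≤_ (λ z → (x ∨ y) ∧ z ≈ y) (x * y)
    nonEmpty   : Carrier

  -- By 𝟏-maximum below, 𝟏 does not depend, up to ≈, on the chosen element.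
  𝟏 : Carrier
  𝟏 = nonEmpty * nonEmpty

  open OrderLattice.Lattice ∨-∧-orderTheoreticLattice
    using (x≤x∨y) renaming (trans to ≤-trans)
  open SetoidReasoning setoid

  x*x-maximum : ∀ x → Maximum _≤_ (x * x)
  x*x-maximum x y =
    ≤-trans (x≤x∨y y x) (proj₂ (*-greatest x x) (y ∨ x) (begin
      (x ∨ x) ∧ (y ∨ x)  ≈⟨ ∧-cong (∨-idem x) (∨-comm y x) ⟩
      x ∧ (x ∨ y)        ≈⟨ ∧-absorbs-∨ x y ⟩
      x                  ∎))

  𝟏-maximum : Maximum _≤_ 𝟏
  𝟏-maximum = x*x-maximum nonEmpty

  x*x≈𝟏 : ∀ x → x * x ≈ 𝟏
  x*x≈𝟏 x = antisym (𝟏-maximum (x * x)) (x*x-maximum x 𝟏)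

  *-cong : ∀ {x y u v} → x ≈ y → u ≈ v → x * u ≈ y * v
  *-cong x≈y u≈v = antisym (half x≈y u≈v) (half (sym x≈y) (sym u≈v))
    where
    half : ∀ {x y u v} → x ≈ y → u ≈ v → x * u ≤ y * v
    half {x} {y} {u} {v} x≈y u≈v = proj₂ (*-greatest y v) (x * u) (begin
      (y ∨ v) ∧ x * u  ≈⟨ ∧-congʳ (∨-cong (sym x≈y) (sym u≈v)) ⟩
      (x ∨ u) ∧ x * u  ≈⟨ proj₁ (*-greatest x u) ⟩
      u                ≈⟨ u≈v ⟩
      v                ∎)

  𝟏*x≈x : ∀ x → 𝟏 * x ≈ x
  𝟏*x≈x x = begin
    𝟏 * x            ≈⟨ 𝟏-maximum (𝟏 * x) ⟩
    𝟏 * x ∧ 𝟏        ≈⟨ ∧-comm (𝟏 * x) 𝟏 ⟩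
    𝟏 ∧ 𝟏 * x        ≈⟨ ∧-congʳ (antisym (x≤x∨y 𝟏 x) (𝟏-maximum (𝟏 ∨ x))) ⟩
    (𝟏 ∨ x) ∧ 𝟏 * x  ≈⟨ proj₁ (*-greatest 𝟏 x) ⟩
    x                ∎

  x≈y⇒x*y≈𝟏 : ∀ {x y} → x ≈ y → x * y ≈ 𝟏
  x≈y⇒x*y≈𝟏 {x} {y} x≈y = begin
    x * y  ≈⟨ *-cong x≈y refl ⟩
    y * y  ≈⟨ x*x≈𝟏 y ⟩
    𝟏      ∎

  record IsFilter (F : Pred Carrier p) : Set (c ⊔ p) where
    field
      𝟏∈F       : 𝟏 ∈ F
      ∨-compat  : ∀ x y z → x * y ∈ F → y * x ∈ F → (x ∨ z) * (y ∨ z) ∈ F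
      ∧-compat  : ∀ x y z → x * y ∈ F → y * x ∈ F → (x ∧ z) * (y ∧ z) ∈ F
      *-compatʳ : ∀ x y z → x * y ∈ F → y * x ∈ F → (x * z) * (y * z) ∈ F
      *-compatˡ : ∀ x y z → x * y ∈ F → y * x ∈ F → (z * x) * (z * y) ∈ F

-- Terms in variables x₁,…,xₙ and y₁,…,yₘ. The greatest element is definable
-- (x * x ≈ 𝟏), but a nullary symbol for it is needed in order to have closed
-- terms such as t₁ below.
data Term (n m : ℕ) : Set where
  x′               : Fin n → Term n m
  y′               : Fin m → Term n m
  𝟏′               : Term n m
  _∨′_ _∧′_ _*′_   : Term n m → Term n m → Term n m

module _ (L : SectionallyPseudocomplementedLattice c ℓ) where
  open SectionallyPseudocomplementedLattice L

  ⟦_⟧ : Term n m → Vector Carrier n → Vector Carrier m → Carrier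
  ⟦ x′ k ⟧   xs ys = xs k
  ⟦ y′ k ⟧   xs ys = ys k
  ⟦ 𝟏′ ⟧     xs ys = 𝟏
  ⟦ s ∨′ t ⟧ xs ys = ⟦ s ⟧ xs ys ∨ ⟦ t ⟧ xs ys
  ⟦ s ∧′ t ⟧ xs ys = ⟦ s ⟧ xs ys ∧ ⟦ t ⟧ xs ys
  ⟦ s *′ t ⟧ xs ys = ⟦ s ⟧ xs ys * ⟦ t ⟧ xs ys

-- The identity is required in all sectionally pseudocomplemented lattices
-- (of the given universe levels).
record IdealTerm c ℓ : Set (suc (c ⊔ ℓ)) where
  field
    {arityˣ arityʸ} : ℕ
    term            : Term arityˣ arityʸ
    ideal           : (L : SectionallyPseudocomplementedLattice c ℓ) →
                      let open SectionallyPseudocomplementedLattice L in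
                      (xs : Vector Carrier arityˣ) →
                      ⟦_⟧ L term xs (λ _ → 𝟏) ≈ 𝟏

module _ (L : SectionallyPseudocomplementedLattice c ℓ) where
  open SectionallyPseudocomplementedLattice L
  open IdealTerm

  ClosedUnder : {I : Set i} → (I → IdealTerm c ℓ) → Pred Carrier p →
                Set (c ⊔ p ⊔ i)
  ClosedUnder t A =
    ∀ k (xs : Vector Carrier (arityˣ (t k))) (ys : Vector Carrier (arityʸ (t k))) →
    (∀ j → ys j ∈ A) → ⟦_⟧ L (term (t k)) xs ys ∈ A

private
  x₁ x₂ x₃ y₁ y₂ u : Term 3 2
  x₁ = x′ 0F
  x₂ = x′ 1F
  x₃ = x′ 2F
  y₁ = y′ 0F
  y₂ = y′ 1F
  u  = ((x₁ ∨′ x₂) ∧′ (y₁ *′ x₂)) ∧′ y₂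

  module _ (L : SectionallyPseudocomplementedLattice c ℓ) where
    open SectionallyPseudocomplementedLattice L
    open SetoidReasoning setoid

    collapseˡ : ∀ x y → ((x ∨ y) ∧ 𝟏 * x) ∧ 𝟏 ≈ x
    collapseˡ x y = begin
      ((x ∨ y) ∧ 𝟏 * x) ∧ 𝟏  ≈⟨ 𝟏-maximum _ ⟨
      (x ∨ y) ∧ 𝟏 * x        ≈⟨ ∧-congˡ (𝟏*x≈x x) ⟩
      (x ∨ y) ∧ x            ≈⟨ ∧-comm (x ∨ y) x ⟩
      x ∧ (x ∨ y)            ≈⟨ ∧-absorbs-∨ x y ⟩
      x                      ∎

    collapseʳ : ∀ x y → ((x ∨ y) ∧ 𝟏 * y) ∧ 𝟏 ≈ y
    collapseʳ x y = begin
      ((x ∨ y) ∧ 𝟏 * y) ∧ 𝟏  ≈⟨ ∧-congʳ (∧-congʳ (∨-comm x y)) ⟩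
      ((y ∨ x) ∧ 𝟏 * y) ∧ 𝟏  ≈⟨ collapseˡ y x ⟩
      y                      ∎

t₁ t₂ t₃ t₄ t₅ : IdealTerm c ℓ

t₁ = record
  { arityˣ = 0
  ; arityʸ = 0
  ; term   = 𝟏′
  ; ideal  = λ L _ → let open SectionallyPseudocomplementedLattice L in refl
  }

t₂ = record
  { term  = (u ∨′ x₃) *′ (x₂ ∨′ x₃)
  ; ideal = λ L xs → let open SectionallyPseudocomplementedLattice L in
      x≈y⇒x*y≈𝟏 (∨-congʳ (collapseʳ L (xs 0F) (xs 1F)))
  }

t₃ = record
  { term  = (u ∧′ x₃) *′ (x₂ ∧′ x₃)
  ; ideal = λ L xs → let open SectionallyPseudocomplementedLattice L in
      x≈y⇒x*y≈𝟏 (∧-congʳ (collapseʳ L (xs 0F) (xs 1F)))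
  }

t₄ = record
  { term  = (u *′ x₃) *′ (x₂ *′ x₃)
  ; ideal = λ L xs → let open SectionallyPseudocomplementedLattice L in
      x≈y⇒x*y≈𝟏 (*-cong (collapseʳ L (xs 0F) (xs 1F)) refl)
  }

t₅ = record
  { term  = (x₃ *′ x₁) *′ (x₃ *′ (((x₁ ∨′ x₂) ∧′ (y₂ *′ x₁)) ∧′ y₁))
  ; ideal = λ L xs → let open SectionallyPseudocomplementedLattice L in
      x≈y⇒x*y≈𝟏 (*-cong refl (sym (collapseˡ L (xs 0F) (xs 1F))))
  }

idealTerms : Vector (IdealTerm c ℓ) 5
idealTerms = t₁ ∷ t₂ ∷ t₃ ∷ t₄ ∷ t₅ ∷ []

{-# OPTIONS --safe #-}
-- Put u = (x₁ ∨ x₂) ∧ (y₁ * x₂) ∧ y₂, so that t₂, t₃, t₄ compare u with x₂.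
-- A filter F is upward closed, and y₁ ∨ x₂ ≤ u * x₂ and y₂ ≤ x₂ * u; hence
-- y₁, y₂ ∈ F make u and x₂ congruent modulo F, and the compatibility
-- conditions give closedness.  Conversely, y₁ = x₁ * x₂ and y₂ = x₂ * x₁ make
-- u ≈ x₁, so that t₂, t₃, t₄ become the compatibility conditions themselves.
-- The term t₅ is treated alike, with the roles of x₁, x₂ and of y₁, y₂ swapped.
module Submission where

open import Defs
open import Data.Fin.Patterns using (0F; 1F; 2F; 3F; 4F)
open import Data.Product.Base using (proj₁; proj₂)
open import Data.Vec.Functional using ([]; _∷_)
open import Function.Bundles using (_⇔_; mk⇔)
open import Level using (Level)
import Relation.Binary.Lattice as OrderLattice
import Relation.Binary.Reasoning.PartialOrder as PosetReasoning
open import Relation.Binary.Definitions using (_Respects_)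
open import Relation.Unary using (Pred; _∈_)

module _ {c ℓ : Level} (L : SectionallyPseudocomplementedLattice c ℓ) where
  open SectionallyPseudocomplementedLattice L
  open OrderLattice.Lattice ∨-∧-orderTheoreticLattice
    using (x≤x∨y; y≤x∨y; ∨-least; x∧y≤x; x∧y≤y; ∧-greatest)
    renaming (refl to ≤-refl; reflexive to ≤-reflexive; trans to ≤-trans)
  open PosetReasoning poset

  [x∨y]∧x*y≈y : ∀ x y → (x ∨ y) ∧ x * y ≈ y
  [x∨y]∧x*y≈y x y = proj₁ (*-greatest x y)

  y≤x*y : ∀ x y → y ≤ x * y
  y≤x*y x y = ≤-trans (≤-reflexive (sym ([x∨y]∧x*y≈y x y))) (x∧y≤y _ _)

  -- Since `y` lies below both `x ∨ y` and `z`, the two inequalities force `(x ∨ y) ∧ z ≈ y`.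
  *-maximal : ∀ {x y z} → y ≤ z → (x ∨ y) ∧ z ≤ y → z ≤ x * y
  *-maximal {x} {y} {z} y≤z [x∨y]∧z≤y = proj₂ (*-greatest x y) z
    (antisym [x∨y]∧z≤y (∧-greatest (y≤x∨y x y) y≤z))

  -- Even `x ∨ y` lies below the right side: `y ≤ x * y` collapses `x * y ∨ y` to `x * y`, whose
  -- meet with `x ∨ y` is `y`.
  x≤[x*y]*y : ∀ x y → x ≤ (x * y) * y
  x≤[x*y]*y x y = ≤-trans (x≤x∨y x y) (*-maximal (y≤x∨y x y) (begin
    (x * y ∨ y) ∧ (x ∨ y)  ≤⟨ ∧-greatest (x∧y≤y _ _)
                               (≤-trans (x∧y≤x _ _) (∨-least ≤-refl (y≤x*y x y))) ⟩
    (x ∨ y) ∧ x * y        ≈⟨ [x∨y]∧x*y≈y x y ⟩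
    y                      ∎))

  u : (x₁ x₂ y₁ y₂ : Carrier) → Carrier
  u x₁ x₂ y₁ y₂ = ((x₁ ∨ x₂) ∧ (y₁ * x₂)) ∧ y₂

  u-recovers-x₁ : ∀ x₁ x₂ → u x₁ x₂ (x₁ * x₂) (x₂ * x₁) ≈ x₁
  u-recovers-x₁ x₁ x₂ = antisym
    (begin
      -- The middle factor is dropped; the outer two already meet in `x₁`.
      u x₁ x₂ (x₁ * x₂) (x₂ * x₁)  ≤⟨ ∧-greatest (≤-trans (x∧y≤x _ _) (x∧y≤x _ _)) (x∧y≤y _ _) ⟩
      (x₁ ∨ x₂) ∧ x₂ * x₁          ≈⟨ ∧-congʳ (∨-comm x₁ x₂) ⟩
      (x₂ ∨ x₁) ∧ x₂ * x₁          ≈⟨ [x∨y]∧x*y≈y x₂ x₁ ⟩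
      x₁                           ∎)
    (∧-greatest (∧-greatest (x≤x∨y x₁ x₂) (x≤[x*y]*y x₁ x₂)) (y≤x*y x₂ x₁))

  -- Both `u` and `x₂` lie below `y₁ * x₂`, which meets `y₁ ∨ x₂` in `x₂`. The join with `x₂` is
  -- there because `*-maximal` needs a candidate above `x₂`.
  y₁∨x₂≤u*x₂ : ∀ x₁ x₂ y₁ y₂ → y₁ ∨ x₂ ≤ u x₁ x₂ y₁ y₂ * x₂
  y₁∨x₂≤u*x₂ x₁ x₂ y₁ y₂ = *-maximal (y≤x∨y y₁ x₂) (begin
    (u x₁ x₂ y₁ y₂ ∨ x₂) ∧ (y₁ ∨ x₂)
      ≤⟨ ∧-greatest (x∧y≤y _ _) (≤-trans (x∧y≤x _ _)
           (∨-least (≤-trans (x∧y≤x _ _) (x∧y≤y _ _)) (y≤x*y y₁ x₂))) ⟩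
    (y₁ ∨ x₂) ∧ y₁ * x₂
      ≈⟨ [x∨y]∧x*y≈y y₁ x₂ ⟩
    x₂ ∎)

  -- The join `x₂ ∨ u` stays below the first two factors of `u`, so meeting it with `y₂` gives at
  -- most `u`.
  y₂≤x₂*u : ∀ x₁ x₂ y₁ y₂ → y₂ ≤ x₂ * u x₁ x₂ y₁ y₂
  y₂≤x₂*u x₁ x₂ y₁ y₂ = *-maximal (x∧y≤y _ _)
    (∧-greatest
      (≤-trans (x∧y≤x _ _)
        (∨-least (∧-greatest (y≤x∨y x₁ x₂) (y≤x*y y₁ x₂)) (x∧y≤x _ _)))
      (x∧y≤y _ _))

  module _ {p : Level} {F : Pred Carrier p} (resp : F Respects _≈_) where

    module _ (isFilter : IsFilter F) where
      open IsFilter isFilter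

      upward-closed : ∀ {x y} → x ≤ y → x ∈ F → y ∈ F
      upward-closed {x} {y} x≤y x∈F = resp
        (trans
          (*-cong (antisym (𝟏-maximum _) (x≤x∨y 𝟏 y))
                  (antisym (∨-least x≤y ≤-refl) (y≤x∨y x y)))
          (𝟏*x≈x y))
        -- An `x` in `F` is congruent to `𝟏`; joining with `y` gives `(𝟏 ∨ y) * (x ∨ y)`, which is
        -- `𝟏 * y ≈ y` as `x ≤ y`.
        (∨-compat 𝟏 x y
          (resp (sym (𝟏*x≈x x)) x∈F)
          (resp (antisym (y≤x*y x 𝟏) (𝟏-maximum _)) 𝟏∈F))

      u*x₂∈F : ∀ x₁ x₂ {y₁ y₂} → y₁ ∈ F → u x₁ x₂ y₁ y₂ * x₂ ∈ F
      u*x₂∈F x₁ x₂ = upward-closed (≤-trans (x≤x∨y _ _) (y₁∨x₂≤u*x₂ x₁ x₂ _ _))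

      x₂*u∈F : ∀ x₁ x₂ {y₁ y₂} → y₂ ∈ F → x₂ * u x₁ x₂ y₁ y₂ ∈ F
      x₂*u∈F x₁ x₂ = upward-closed (y₂≤x₂*u x₁ x₂ _ _)

      filter⇒closed : ClosedUnder L idealTerms F
      filter⇒closed 0F xs ys ys∈F = 𝟏∈F
      filter⇒closed 1F xs ys ys∈F = ∨-compat _ _ _
        (u*x₂∈F (xs 0F) (xs 1F) (ys∈F 0F)) (x₂*u∈F (xs 0F) (xs 1F) (ys∈F 1F))
      filter⇒closed 2F xs ys ys∈F = ∧-compat _ _ _
        (u*x₂∈F (xs 0F) (xs 1F) (ys∈F 0F)) (x₂*u∈F (xs 0F) (xs 1F) (ys∈F 1F))
      filter⇒closed 3F xs ys ys∈F = *-compatʳ _ _ _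
        (u*x₂∈F (xs 0F) (xs 1F) (ys∈F 0F)) (x₂*u∈F (xs 0F) (xs 1F) (ys∈F 1F))
      -- Up to commuting the join, the inner element of `t₅` is `u x₂ x₁ y₂ y₁`.
      filter⇒closed 4F xs ys ys∈F = resp
        (*-cong refl (*-cong refl (∧-congʳ (∧-congʳ (∨-comm (xs 1F) (xs 0F))))))
        (*-compatˡ _ _ (xs 2F)
          (x₂*u∈F (xs 1F) (xs 0F) (ys∈F 0F)) (u*x₂∈F (xs 1F) (xs 0F) (ys∈F 1F)))

    closed⇒filter : ClosedUnder L idealTerms F → IsFilter F
    closed⇒filter closed = record
      { 𝟏∈F       = closed 0F [] [] λ ()
      ; ∨-compat  = λ x y z x*y∈F y*x∈F → resp
          (*-cong (∨-congʳ (u-recovers-x₁ x y)) refl)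
          (closed 1F (x ∷ y ∷ z ∷ []) _ (both x*y∈F y*x∈F))
      ; ∧-compat  = λ x y z x*y∈F y*x∈F → resp
          (*-cong (∧-congʳ (u-recovers-x₁ x y)) refl)
          (closed 2F (x ∷ y ∷ z ∷ []) _ (both x*y∈F y*x∈F))
      ; *-compatʳ = λ x y z x*y∈F y*x∈F → resp
          (*-cong (*-cong (u-recovers-x₁ x y) refl) refl)
          (closed 3F (x ∷ y ∷ z ∷ []) _ (both x*y∈F y*x∈F))
      -- With the roles swapped, the inner element of `t₅` collapses to `y` while `x` stands
      -- untouched on the left.
      ; *-compatˡ = λ x y z x*y∈F y*x∈F → resp
          (*-cong refl (*-cong refl
            (trans (∧-congʳ (∧-congʳ (∨-comm x y))) (u-recovers-x₁ y x))))
          (closed 4F (x ∷ y ∷ z ∷ []) _ (both x*y∈F y*x∈F))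
      }
      where
      both : ∀ {a b} → a ∈ F → b ∈ F → ∀ j → (a ∷ b ∷ []) j ∈ F
      both a∈F b∈F 0F = a∈F
      both a∈F b∈F 1F = b∈F

theorem4p8 : ∀ {c ℓ p : Level} (L : SectionallyPseudocomplementedLattice c ℓ) →
    let open SectionallyPseudocomplementedLattice L in
    (F : Pred Carrier p) → F Respects _≈_ →
    IsFilter F ⇔ ClosedUnder L idealTerms F
theorem4p8 L F resp = mk⇔ (filter⇒closed L resp) (closed⇒filter L resp)
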